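{- Let $\exists X_1 \cdots \exists X_n\, \psi$ be a valid linear Horn formula equation over a first-order language $\mathcal{L}$, and let $\mu_j = [\mathrm{lfp}_{X_j}\, \Phi_{\psi}]$ and $\nu_j = \neg [\mathrm{lfp}_{X_j}\, \Phi_{\psi^D}]$ for $j = 1,\ldots,n$. Then: 1. $\models \psi[X_1\backslash\mu_1,\ldots,X_n\backslash\mu_n]$ and $\models \psi[X_1\backslash\nu_1,\ldots,X_n\backslash\nu_n]$. 2. If $\models \psi[X_1\backslash\chi_1,\ldots,X_n\backslash\chi_n]$ for FO[LFP]-formulas $\chi_1,\ldots,\chi_n$, then $\models \bigwedge_{j=1}^n ( ( \mu_j \rightarrow \chi_j) \land ( \chi_j \rightarrow \nu_j ))$.
   Context: Fix a first-order language $\mathcal{L}$ (with equality). Formulas may contain predicate variables $X,Y,\ldots$, each with an arity. $\mathcal{M},I\models\varphi$ is Tarski satisfaction (second-order quantifiers range over all relations on the domain) and $\models\varphi$ means that $\varphi$ is valid, i.e. true in all $\mathcal{L}$-structures. $\bot$ is always false. If $X$ is $k$-ary and $\chi$ is a formula with free variables $v_1,\ldots,v_k$, then $[X\backslash\chi]$ replaces every atom $X(t_1,\ldots,t_k)$ by $\chi$ with $t_i$ inserted for $v_i$; $[X_1\backslash\chi_1,\ldots,X_n\backslash\chi_n]$ is the simultaneous substitution (similarly with predicates or relations in place of the $\chi_i$). An implication such as $\mu_j\to\chi_j$ between predicates or formulas of the same arity means $\forall \overline{x}\,(\mu_j(\overline{x})\to\chi_j(\overline{x}))$; $\neg[\mathrm{lfp}\ldots]$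 is the complementary predicate. Horn formula equations: a constrained Horn clause is a formula $\varphi \land X_{i_1}(\overline{t_1}) \land \cdots \land X_{i_m}(\overline{t_m}) \to X_{i_0}(\overline{s})$ or $\varphi \land X_{i_1}(\overline{t_1}) \land \cdots \land X_{i_m}(\overline{t_m}) \to \bot$, $m\ge 0$, where $\varphi$ is a first-order $\mathcal{L}$-formula without predicate variables and $\overline{t_1},\ldots,\overline{t_m},\overline{s}$ are tuples of $\mathcal{L}$-terms of appropriate arity. A dual constrained Horn clause is a formula $\varphi\land X_{i_0}(\overline{t})\to X_{i_1}(\overline{s_1})\lor\cdots\lor X_{i_m}(\overline{s_m})$ or $\varphi\to X_{i_1}(\overline{s_1})\lor\cdots\lor X_{i_m}(\overline{s_m})$, $m\ge0$ (the empty disjunction being $\bot$), with $\varphi$ and the terms as before. Clauses may contain free individual variables. A Horn formula equation (resp. dual Horn formula equation) is a formula $\exists X_1\cdots\exists X_n\,\psi$ where $\psi$ is $\forall^*\bigwedge_{C\in S}C$ for a finite set $S$ of constrained Horn clauses (resp. dual constrained Horn clauses) in the predicate variables $X_1,\ldots,X_n$, $\forall^*$ being universal closure over individual variables. A linear Horn formula equation is one that is both Horn and dual Horn. A formula equation is valid if it is a valid second-order formula. FO[LFP]: first-order logic extended by simultaneous least fixed points. For a tuple $\Phi=(\varphi_i(X_1,\ldots,X_n,\overline{u_i}))_{i=1}^n$ of formulas in which the $X_j$ occur only positively, with $|\overline{u_i}|=k_i$ the arity of $X_i$, and a structure $\mathcal{M}$ with domain $M$, the operator $F_\Phi=(F_1,\ldots,F_n)$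 on $\mathcal{P}(M^{k_1})\times\cdots\times\mathcal{P}(M^{k_n})$ is defined by $F_i(R_1,\ldots,R_n)=\{\overline{a}\in M^{k_i}\mid \mathcal{M}\models\varphi_i(R_1,\ldots,R_n,\overline{a})\}$. It is monotone; the predicate $[\mathrm{lfp}_{X_i}\,\Phi]$ is interpreted in $\mathcal{M}$ as the $i$-th component of the least fixed point of $F_\Phi$. The tuple $\Phi_\psi$ for a Horn formula equation $\exists X_1\cdots\exists X_n\,\psi$: let $B_j$ be the set of clauses of $\psi$ of the form $\varphi\to X_j(\overline{s})$, written $(\varphi,\overline{s})$, and $I_j$ the set of clauses of the form $\varphi\land X_{i_1}(\overline{t_1})\land\cdots\land X_{i_m}(\overline{t_m})\to X_j(\overline{s})$ with $m\ge1$, written $(\varphi,\iota,\tau,\overline{s})$ with $\iota=(i_1,\ldots,i_m)$, $\tau=(\overline{t_1},\ldots,\overline{t_m})$. Then $\Phi_\psi=(\varphi_j(X_1,\ldots,X_n,\overline{x_j}))_{j=1}^n$, where $\varphi_j$ is $$\exists \overline{y}\left(\bigvee_{(\varphi,\overline{s})\in B_j}(\varphi\land\overline{x_j}=\overline{s})\lor\bigvee_{(\varphi,\iota,\tau,\overline{s})\in I_j}\Big(\varphi\land\bigwedge_{k=1}^m X_{i_k}(\overline{t_k})\land\overline{x_j}=\overline{s}\Big)\right),$$ $\overline{y}$ being the free variables of the clauses in $B_j\cup I_j$ and $\overline{x_j}$ a tuple of fresh variables whose length is the arity of $X_j$ (empty disjunctions are false). Dualisation: $\psi^D$ is $\psi[X_1\backslash\neg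 X_1,\ldots,X_n\backslash\neg X_n]$. If $\exists\overline{X}\,\psi$ is dual Horn, $\psi^D$ is identified with the logically equivalent conjunction of constrained Horn clauses obtained by contraposition: the clause $\varphi\land X_{i_0}(\overline{t})\to\bigvee_k X_{i_k}(\overline{s_k})$ becomes $\varphi\land\bigwedge_k X_{i_k}(\overline{s_k})\to X_{i_0}(\overline{t})$, and $\varphi\to\bigvee_k X_{i_k}(\overline{s_k})$ becomes $\varphi\land\bigwedge_k X_{i_k}(\overline{s_k})\to\bot$; $\Phi_{\psi^D}$ is formed from these clauses. -}

module Defs where

open import Level using (0ℓ)
open import Data.Bool.Base using (Bool; T)
open import Data.Empty using (⊥)
open import Data.Fin.Base using (Fin; zero; suc; _↑ˡ_; _↑ʳ_)
open import Data.Fin.Properties using (_≟_)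
import Data.Fin.Subset as Subset
open import Data.Fin.Subset using (Subset; outside; _∉_)
open import Data.List.Base as List using (List; []; _∷_)
open import Data.List.Relation.Unary.All as ListAll using ([]; _∷_)
import Data.List.Relation.Unary.All.Properties as ListAll
open import Data.Maybe.Base as Maybe using (Maybe; just; nothing)
open import Data.Nat.Base using (ℕ; zero; suc; _+_; _≤_)
open import Data.Product.Base using (Σ-syntax; ∃; _×_; _,_)
open import Data.Sign.Base as Sign using (Sign; opposite)
open import Data.Sum.Base using (_⊎_; inj₁)
open import Data.Unit.Base using (⊤; tt)
open import Data.Vec.Base as Vec using (Vec; []; _∷_; _++_; lookup)
open import Data.Vec.Relation.Unary.All using (All; []; _∷_)
open import Data.Vec.Relation.Unary.All.Properties using (lookup⁺; ++⁺)
open import Function.Base using (_∘_)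
open import Function.Bundles using (_⇔_)
open import Relation.Binary.PropositionalEquality.Core using (_≡_; refl)
open import Relation.Nullary using (¬_; yes; no)
open import Relation.Unary using (Pred)

record Language : Set₁ where
  field
    Fun : ℕ → Set
    Rel : ℕ → Set

open Language public

data Term (L : Language) (p : ℕ) : Set where
  var : Fin p → Term L p
  fun : ∀ {k} → Fun L k → Vec (Term L p) k → Term L p

data Logic : Set where
  FO FO[LFP] SO : Logic

infix  9 _·_
infix  8 _≐_
infix  7 ¬′_
infixr 6 _∧′_
infixr 5 _∨′_
infixr 4 _⇒_

-- `Formula L l Δ p`: formulas of the logic l with free predicate variables
-- X₁, …, Xₙ of the arities listed in Δ and p free individual variables.
-- Both sorts of variables are de Bruijn indices; a quantifier binds index 0.
-- In `lfp ks Φ _ i ts`, that is [lfp_{Xᵢ} Φ](ts), the bound predicate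
-- variables come after those of Δ, and the tuple uᵢ comes before the p outer
-- individual variables, which may occur in Φ as parameters.

data Formula (L : Language) :
  Logic → ∀ {n} → Vec ℕ n → ℕ → Set

-- `Polar s S φ`: the predicate variables in S occur in φ only with sign s.

Polar : ∀ {L l n} {Δ : Vec ℕ n} {p} →
        Sign → Subset n → Formula L l Δ p → Set

data Formula L where
  ⊥′ ⊤′     : ∀ {l n} {Δ : Vec ℕ n} {p} → Formula L l Δ p
  _≐_       : ∀ {l n} {Δ : Vec ℕ n} {p} →
              Term L p → Term L p → Formula L l Δ p
  rel       : ∀ {l n} {Δ : Vec ℕ n} {p k} →
              Rel L k → Vec (Term L p) k → Formula L l Δ p
  _·_       : ∀ {l n} {Δ : Vec ℕ n} {p} →
              (X : Fin n) → Vec (Term L p) (lookup Δ X) → Formula L l Δ p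
  ¬′_       : ∀ {l n} {Δ : Vec ℕ n} {p} →
              Formula L l Δ p → Formula L l Δ p
  _∧′_ _∨′_ _⇒_ :
              ∀ {l n} {Δ : Vec ℕ n} {p} →
              Formula L l Δ p → Formula L l Δ p → Formula L l Δ p
  ∀′ ∃′     : ∀ {l n} {Δ : Vec ℕ n} {p} →
              Formula L l Δ (suc p) → Formula L l Δ p
  ∀ᵖ ∃ᵖ     : ∀ {n} {Δ : Vec ℕ n} {p k} →
              Formula L SO (k ∷ Δ) p → Formula L SO Δ p
  lfp       : ∀ {n} {Δ : Vec ℕ n} {p m} (ks : Vec ℕ m)
              (Φ : ∀ i → Formula L FO[LFP] (Δ ++ ks) (lookup ks i + p)) →
              .(∀ i → Polar Sign.+ (Subset.⊥ {n} ++ Subset.⊤ {m}) (Φ i)) →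
              (i : Fin m) → Vec (Term L p) (lookup ks i) →
              Formula L FO[LFP] Δ p

Polar s S ⊥′        = ⊤
Polar s S ⊤′        = ⊤
Polar s S (t ≐ u)   = ⊤
Polar s S (rel r t) = ⊤
Polar s S (X · ts)  = s ≡ Sign.+ ⊎ X ∉ S
Polar s S (¬′ φ)    = Polar (opposite s) S φ
Polar s S (φ ∧′ χ)  = Polar s S φ × Polar s S χ
Polar s S (φ ∨′ χ)  = Polar s S φ × Polar s S χ
Polar s S (φ ⇒ χ)   = Polar (opposite s) S φ × Polar s S χ
Polar s S (∀′ φ)    = Polar s S φ
Polar s S (∃′ φ)    = Polar s S φ
Polar s S (∀ᵖ φ)    = Polar s (outside ∷ S) φ
Polar s S (∃ᵖ φ)    = Polar s (outside ∷ S) φ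
Polar s S (lfp {m = m} ks Φ _ i ts) = ∀ j → Polar s (S ++ Subset.⊥ {m}) (Φ j)

⋀ : ∀ {L l n} {Δ : Vec ℕ n} {p} → List (Formula L l Δ p) → Formula L l Δ p
⋀ []               = ⊤′
⋀ (φ ∷ [])         = φ
⋀ (φ ∷ φs@(_ ∷ _)) = φ ∧′ ⋀ φs

⋁ : ∀ {L l n} {Δ : Vec ℕ n} {p} → List (Formula L l Δ p) → Formula L l Δ p
⋁ []               = ⊥′
⋁ (φ ∷ [])         = φ
⋁ (φ ∷ φs@(_ ∷ _)) = φ ∨′ ⋁ φs

∀* : ∀ {L l n} {Δ : Vec ℕ n} {p} → Formula L l Δ p → Formula L l Δ 0
∀* {p = zero}  φ = φ
∀* {p = suc p} φ = ∀* (∀′ φ)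

∃* : ∀ {L l n} {Δ : Vec ℕ n} p {q} → Formula L l Δ (p + q) → Formula L l Δ q
∃* zero    φ = φ
∃* (suc p) φ = ∃* p (∃′ φ)

∃ᵖ* : ∀ {L n} {Δ : Vec ℕ n} {p} → Formula L SO Δ p → Formula L SO [] p
∃ᵖ* {Δ = []}    φ = φ
∃ᵖ* {Δ = k ∷ Δ} φ = ∃ᵖ* (∃ᵖ φ)

sub  : ∀ {L p q} → (Fin p → Term L q) → Term L p → Term L q
subs : ∀ {L p q k} → (Fin p → Term L q) → Vec (Term L p) k → Vec (Term L q) k

sub σ (var x)    = σ x
sub σ (fun f ts) = fun f (subs σ ts)

subs σ []       = []
subs σ (t ∷ ts) = sub σ t ∷ subs σ ts

lift : ∀ {L p q} → (Fin p → Term L q) → Fin (suc p) → Term L (suc q)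
lift σ zero    = var zero
lift σ (suc x) = sub (var ∘ suc) (σ x)

lift* : ∀ {L p q} k → (Fin p → Term L q) → Fin (k + p) → Term L (k + q)
lift* zero    σ = σ
lift* (suc k) σ = lift (lift* k σ)

_⟨_⟩ : ∀ {L l n} {Δ : Vec ℕ n} {p q} →
       Formula L l Δ p → (Fin p → Term L q) → Formula L l Δ q

Polar-⟨⟩ : ∀ {L l n} {Δ : Vec ℕ n} {p q s S} {σ : Fin p → Term L q}
           (φ : Formula L l Δ p) → Polar s S φ → Polar s S (φ ⟨ σ ⟩)

⊥′        ⟨ σ ⟩ = ⊥′
⊤′        ⟨ σ ⟩ = ⊤′
(t ≐ u)   ⟨ σ ⟩ = sub σ t ≐ sub σ u
rel r ts  ⟨ σ ⟩ = rel r (subs σ ts)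
(X · ts)  ⟨ σ ⟩ = X · subs σ ts
(¬′ φ)    ⟨ σ ⟩ = ¬′ (φ ⟨ σ ⟩)
(φ ∧′ χ)  ⟨ σ ⟩ = (φ ⟨ σ ⟩) ∧′ (χ ⟨ σ ⟩)
(φ ∨′ χ)  ⟨ σ ⟩ = (φ ⟨ σ ⟩) ∨′ (χ ⟨ σ ⟩)
(φ ⇒ χ)   ⟨ σ ⟩ = (φ ⟨ σ ⟩) ⇒ (χ ⟨ σ ⟩)
∀′ φ      ⟨ σ ⟩ = ∀′ (φ ⟨ lift σ ⟩)
∃′ φ      ⟨ σ ⟩ = ∃′ (φ ⟨ lift σ ⟩)
∀ᵖ φ      ⟨ σ ⟩ = ∀ᵖ (φ ⟨ σ ⟩)
∃ᵖ φ      ⟨ σ ⟩ = ∃ᵖ (φ ⟨ σ ⟩)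
lfp ks Φ pos i ts ⟨ σ ⟩ =
  lfp ks (λ j → Φ j ⟨ lift* (lookup ks j) σ ⟩)
      (λ j → Polar-⟨⟩ (Φ j) (pos j)) i (subs σ ts)

Polar-⟨⟩ ⊥′        _       = tt
Polar-⟨⟩ ⊤′        _       = tt
Polar-⟨⟩ (t ≐ u)   _       = tt
Polar-⟨⟩ (rel r t) _       = tt
Polar-⟨⟩ (X · ts)  P       = P
Polar-⟨⟩ (¬′ φ)    P       = Polar-⟨⟩ φ P
Polar-⟨⟩ (φ ∧′ χ)  (P , Q) = Polar-⟨⟩ φ P , Polar-⟨⟩ χ Q
Polar-⟨⟩ (φ ∨′ χ)  (P , Q) = Polar-⟨⟩ φ P , Polar-⟨⟩ χ Q
Polar-⟨⟩ (φ ⇒ χ)   (P , Q) = Polar-⟨⟩ φ P , Polar-⟨⟩ χ Q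
Polar-⟨⟩ (∀′ φ)    P       = Polar-⟨⟩ φ P
Polar-⟨⟩ (∃′ φ)    P       = Polar-⟨⟩ φ P
Polar-⟨⟩ (∀ᵖ φ)    P       = Polar-⟨⟩ φ P
Polar-⟨⟩ (∃ᵖ φ)    P       = Polar-⟨⟩ φ P
Polar-⟨⟩ (lfp ks Φ _ i ts) P = λ j → Polar-⟨⟩ (Φ j) (P j)

-- Simultaneous substitution [X₁\χ₁,…,Xₙ\χₙ]. As χⱼ has no free individual variables but v₁, …, v_{kⱼ},
-- nothing has to be renamed when passing under a quantifier.

_[_] : ∀ {L l m n} {Δ : Vec ℕ m} {Δ′ : Vec ℕ n} {p} →
       Formula L FO Δ p → (∀ j → Formula L l Δ′ (lookup Δ j)) →
       Formula L l Δ′ p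
⊥′       [ χ ] = ⊥′
⊤′       [ χ ] = ⊤′
(t ≐ u)  [ χ ] = t ≐ u
rel r ts [ χ ] = rel r ts
(X · ts) [ χ ] = χ X ⟨ lookup ts ⟩
(¬′ φ)   [ χ ] = ¬′ (φ [ χ ])
(φ ∧′ θ) [ χ ] = (φ [ χ ]) ∧′ (θ [ χ ])
(φ ∨′ θ) [ χ ] = (φ [ χ ]) ∨′ (θ [ χ ])
(φ ⇒ θ)  [ χ ] = (φ [ χ ]) ⇒ (θ [ χ ])
∀′ φ     [ χ ] = ∀′ (φ [ χ ])
∃′ φ     [ χ ] = ∃′ (φ [ χ ])

-- A first-order formula without predicate variables is a formula of every
-- logic over every list of predicate variables.

embed : ∀ {L l n} {Δ : Vec ℕ n} {p} → Formula L FO [] p → Formula L l Δ p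
embed φ = φ [ (λ ()) ]

record Structure (L : Language) : Set₁ where
  field
    Carrier : Set
    point   : Carrier
    ⟦_⟧ᶠ    : ∀ {k} → Fun L k → Vec Carrier k → Carrier
    ⟦_⟧ʳ    : ∀ {k} → Rel L k → Vec Carrier k → Bool

open Structure public

⟦_⟧  : ∀ {L p} → Term L p → (M : Structure L) → Vec (Carrier M) p → Carrier M
⟦_⟧* : ∀ {L p k} → Vec (Term L p) k → (M : Structure L) →
       Vec (Carrier M) p → Vec (Carrier M) k

⟦ var x ⟧    M ρ = lookup ρ x
⟦ fun f ts ⟧ M ρ = ⟦ M ⟧ᶠ f (⟦ ts ⟧* M ρ)

⟦ [] ⟧*     M ρ = []
⟦ t ∷ ts ⟧* M ρ = ⟦ t ⟧ M ρ ∷ ⟦ ts ⟧* M ρ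

-- Relations are two-valued, so that the k-ary relations on M form a type in
-- the same universe as M. Under excluded middle (in Set) every subset of
-- Vec (Carrier M) k is given by such a relation, which is what makes
-- second-order quantification and least fixed points the intended ones.

Relation : ∀ {L} → Structure L → ℕ → Set
Relation M k = Vec (Carrier M) k → Bool

Relations : ∀ {L n} → Structure L → Vec ℕ n → Set
Relations M = All (Relation M)

Operator : ∀ {L n} → Structure L → Vec ℕ n → Set₁
Operator M ks = Relations M ks → ∀ i → Pred (Vec (Carrier M) (lookup ks i)) 0ℓ

module _ {L : Language} (M : Structure L) {n : ℕ} {ks : Vec ℕ n} where

  holds : Relations M ks → (i : Fin n) → Pred (Vec (Carrier M) (lookup ks i)) 0ℓ
  holds R i a = T (lookup⁺ R i a)

  IsFixedPoint : Operator M ks → Relations M ks → Set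
  IsFixedPoint F R = ∀ i a → holds R i a ⇔ F R i a

  IsLeastFixedPoint : Operator M ks → Relations M ks → Set
  IsLeastFixedPoint F R =
    IsFixedPoint F R ×
    (∀ S → IsFixedPoint F S → ∀ i a → holds R i a → holds S i a)

  -- Membership in the i-th component of "the" least fixed point of F, read
  -- as a definite description: it also asserts that F has one.

  LeastFixedPoint : Operator M ks → ∀ i → Pred (Vec (Carrier M) (lookup ks i)) 0ℓ
  LeastFixedPoint F i a = ∃ λ R → IsLeastFixedPoint F R × holds R i a

Sat : ∀ {L l n} {Δ : Vec ℕ n} {p} (M : Structure L) →
      Relations M Δ → Vec (Carrier M) p → Formula L l Δ p → Set
Sat M I ρ ⊥′         = ⊥
Sat M I ρ ⊤′         = ⊤
Sat M I ρ (t ≐ u)    = ⟦ t ⟧ M ρ ≡ ⟦ u ⟧ M ρ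
Sat M I ρ (rel r ts) = T (⟦ M ⟧ʳ r (⟦ ts ⟧* M ρ))
Sat M I ρ (X · ts)   = holds M I X (⟦ ts ⟧* M ρ)
Sat M I ρ (¬′ φ)     = ¬ Sat M I ρ φ
Sat M I ρ (φ ∧′ χ)   = Sat M I ρ φ × Sat M I ρ χ
Sat M I ρ (φ ∨′ χ)   = Sat M I ρ φ ⊎ Sat M I ρ χ
Sat M I ρ (φ ⇒ χ)    = Sat M I ρ φ → Sat M I ρ χ
Sat M I ρ (∀′ φ)     = (a : Carrier M) → Sat M I (a ∷ ρ) φ
Sat M I ρ (∃′ φ)     = Σ[ a ∈ Carrier M ] Sat M I (a ∷ ρ) φ
Sat M I ρ (∀ᵖ {k = k} φ) = (R : Relation M k) → Sat M (R ∷ I) ρ φ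
Sat M I ρ (∃ᵖ {k = k} φ) = Σ[ R ∈ Relation M k ] Sat M (R ∷ I) ρ φ
Sat M I ρ (lfp ks Φ _ i ts) =
  LeastFixedPoint M (λ R j a → Sat M (++⁺ I R) (a ++ ρ) (Φ j)) i (⟦ ts ⟧* M ρ)

infix 3 ⊨_

⊨_ : ∀ {L l} → Formula L l [] 0 → Set₁
⊨_ {L} φ = (M : Structure L) → Sat M [] [] φ

Atom : Language → ∀ {n} → Vec ℕ n → ℕ → Set
Atom L {n} ks p = Σ[ X ∈ Fin n ] Vec (Term L p) (lookup ks X)

atom : ∀ {L l n} {ks : Vec ℕ n} {p} → Atom L ks p → Formula L l ks p
atom (X , ts) = X · ts

-- constraint ∧ ⋀ body → ⋁ head. All clauses of a formula equation share the
-- list y₁, …, y_p of individual variables, not all of which need occur in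
-- every clause.

record Clause (L : Language) {n} (ks : Vec ℕ n) (p : ℕ) : Set where
  field
    constraint : Formula L FO [] p
    body       : List (Atom L ks p)
    head       : List (Atom L ks p)

open Clause public

premise : ∀ {L l n} {ks : Vec ℕ n} {p} → Clause L ks p → List (Formula L l ks p)
premise C = embed (constraint C) ∷ List.map atom (body C)

clause : ∀ {L l n} {ks : Vec ℕ n} {p} → Clause L ks p → Formula L l ks p
clause C = ⋀ (premise C) ⇒ ⋁ (List.map atom (head C))

matrix : ∀ {L l n} {ks : Vec ℕ n} {p} → List (Clause L ks p) → Formula L l ks 0
matrix ψ = ∀* (⋀ (List.map clause ψ))

formulaEquation : ∀ {L n} {ks : Vec ℕ n} {p} →
                  List (Clause L ks p) → Formula L SO [] 0
formulaEquation ψ = ∃ᵖ* (matrix ψ)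

Horn DualHorn LinearHorn :
  ∀ {L n} {ks : Vec ℕ n} {p} → List (Clause L ks p) → Set
Horn       = ListAll.All (λ C → List.length (head C) ≤ 1)
DualHorn   = ListAll.All (λ C → List.length (body C) ≤ 1)
LinearHorn ψ = Horn ψ × DualHorn ψ

-- ψᴰ, each clause being contraposed after replacing Xᵢ by ¬Xᵢ.

dual : ∀ {L n} {ks : Vec ℕ n} {p} → List (Clause L ks p) → List (Clause L ks p)
dual = List.map λ C → record
  { constraint = constraint C ; body = head C ; head = body C }

module _ {L : Language} {n} {ks : Vec ℕ n} {p : ℕ} where

  conclusion : (j : Fin n) → Clause L ks p → Maybe (Vec (Term L p) (lookup ks j))
  conclusion j C with head C
  ... | []            = nothing
  ... | _ ∷ _ ∷ _     = nothing
  ... | (X , ts) ∷ [] with X ≟ j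
  ...   | yes refl = just ts
  ...   | no _     = nothing

  -- The free variables are y₁, …, y_p followed by xⱼ. The clauses in Bⱼ and
  -- those in Iⱼ are treated alike, the former being those with empty body.

  disjunct : ∀ {l} j → Clause L ks p → Vec (Term L p) (lookup ks j) →
             Formula L l ks (p + lookup ks j)
  disjunct j C s = ⋀ (List.map _⟨ y ⟩ (premise C) List.++
                      List.tabulate (λ i → var (p ↑ʳ i) ≐ sub y (lookup s i)))
    where
    y : Fin p → Term L (p + lookup ks j)
    y v = var (v ↑ˡ lookup ks j)

  disjuncts : ∀ {l} j → List (Clause L ks p) →
              List (Formula L l ks (p + lookup ks j))
  disjuncts j = List.mapMaybe λ C → Maybe.map (disjunct j C) (conclusion j C)

  Φ : ∀ {l} → List (Clause L ks p) → ∀ j → Formula L l ks (lookup ks j)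
  Φ ψ j = ∃* p (⋁ (disjuncts j ψ))

module _ {L : Language} where

  ⋀-positive : ∀ {l n} {Δ : Vec ℕ n} {p s S} {φs : List (Formula L l Δ p)} →
               ListAll.All (Polar s S) φs → Polar s S (⋀ φs)
  ⋀-positive []               = tt
  ⋀-positive (P ∷ [])         = P
  ⋀-positive (P ∷ Ps@(_ ∷ _)) = P , ⋀-positive Ps

  ⋁-positive : ∀ {l n} {Δ : Vec ℕ n} {p s S} {φs : List (Formula L l Δ p)} →
               ListAll.All (Polar s S) φs → Polar s S (⋁ φs)
  ⋁-positive []               = tt
  ⋁-positive (P ∷ [])         = P
  ⋁-positive (P ∷ Ps@(_ ∷ _)) = P , ⋁-positive Ps

  ∃*-positive : ∀ {l n} {Δ : Vec ℕ n} p {q s S} (φ : Formula L l Δ (p + q)) →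
                Polar s S φ → Polar s S (∃* p φ)
  ∃*-positive zero    φ P = P
  ∃*-positive (suc p) φ P = ∃*-positive p (∃′ φ) P

  embed-polar : ∀ {l n} {Δ : Vec ℕ n} {p s S} (φ : Formula L FO [] p) →
                Polar s S (embed {l = l} {Δ = Δ} φ)
  embed-polar ⊥′        = tt
  embed-polar ⊤′        = tt
  embed-polar (t ≐ u)   = tt
  embed-polar (rel r t) = tt
  embed-polar (¬′ φ)    = embed-polar φ
  embed-polar (φ ∧′ χ)  = embed-polar φ , embed-polar χ
  embed-polar (φ ∨′ χ)  = embed-polar φ , embed-polar χ
  embed-polar (φ ⇒ χ)   = embed-polar φ , embed-polar χ
  embed-polar (∀′ φ)    = embed-polar φ
  embed-polar (∃′ φ)    = embed-polar φ

  module _ {l : Logic} {n} {ks : Vec ℕ n} {p : ℕ} {S : Subset n} where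

    premise-positive : (C : Clause L ks p) →
                       ListAll.All (Polar Sign.+ S) (premise {l = l} C)
    premise-positive C =
      embed-polar (constraint C) ∷
      ListAll.map⁺ (ListAll.universal (λ _ → inj₁ refl) (body C))

    disjunct-positive : ∀ j (C : Clause L ks p) s →
                        Polar Sign.+ S (disjunct {l = l} j C s)
    disjunct-positive j C s = ⋀-positive (ListAll.++⁺
      (ListAll.map⁺ (ListAll.map (λ {φ} → Polar-⟨⟩ φ) (premise-positive C)))
      (ListAll.tabulate⁺ (λ _ → tt)))

    Φ-positive : ∀ (ψ : List (Clause L ks p)) j → Polar Sign.+ S (Φ {l = l} ψ j)
    Φ-positive ψ j = ∃*-positive p _ (⋁-positive (disjuncts-positive ψ))
      where
      disjuncts-positive : ∀ ψ → ListAll.All (Polar Sign.+ S) (disjuncts {l = l} j ψ)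
      disjuncts-positive []      = []
      disjuncts-positive (C ∷ ψ) with conclusion j C
      ... | nothing = disjuncts-positive ψ
      ... | just s  = disjunct-positive j C s ∷ disjuncts-positive ψ

-- The predicates [lfp_{Xⱼ} Φ_ψ] and ¬[lfp_{Xⱼ} Φ_{ψᴰ}], given as formulas
-- whose kⱼ free variables are the arguments.

module _ {L : Language} {n} {ks : Vec ℕ n} {p : ℕ} where

  μ ν : List (Clause L ks p) → ∀ j → Formula L FO[LFP] [] (lookup ks j)
  μ ψ j = lfp ks (λ i → Φ ψ i ⟨ (λ x → var (x ↑ˡ lookup ks j)) ⟩)
              (λ i → Polar-⟨⟩ (Φ ψ i) (Φ-positive ψ i))
              j (Vec.tabulate var)
  ν ψ j = ¬′ μ (dual ψ) j

infix 4 _⟶_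

_⟶_ : ∀ {L l n} {Δ : Vec ℕ n} {k} →
      Formula L l Δ k → Formula L l Δ k → Formula L l Δ 0
φ ⟶ χ = ∀* (φ ⇒ χ)

{-# OPTIONS --safe #-}
module Submission where

-- A tuple is closed under F_{Φ_ψ} iff it satisfies those clauses of ψ that
-- have a predicate variable as head, so the least closed tuple lies below every
-- model of ψ. It then satisfies the clauses with head ⊥ as well, because their
-- premises are monotone and a model exists: it is the least model of ψ.
-- Complementation exchanges models of ψ and of ψᴰ, so the complement of the
-- least model of ψᴰ is the greatest model of ψ. The relations defined by
-- formulas χ solving the equation form a model, hence lie between the two.

open import Defs
open import Level using (0ℓ)
open import Axiom.ExcludedMiddle using (ExcludedMiddle)
open import Data.Bool.Properties using (T?)
open import Data.Fin.Base using (Fin; zero; suc; _↑ˡ_; _↑ʳ_)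
open import Data.Fin.Properties using (_≟_)
open import Data.List.Base as List using (List; []; _∷_; tabulate)
open import Data.List.Relation.Unary.All as ListAll using ([]; _∷_)
import Data.List.Relation.Unary.All.Properties as ListAll
open import Data.List.Relation.Unary.Any as Any using (Any; here; there)
import Data.List.Relation.Unary.Any.Properties as Any
open import Data.Maybe.Base using (just; nothing)
open import Data.Maybe.Properties using (just-injective)
open import Data.Nat.Base using (ℕ; zero; suc; _+_; _≤_; s≤s)
open import Data.Product.Base using (∃; _×_; _,_; map₂)
open import Data.Product.Function.NonDependent.Propositional using (_×-⇔_)
open import Data.Sum.Base using (_⊎_)
open import Data.Sum.Function.Propositional using (_⊎-⇔_)
open import Data.Vec.Base as Vec using (Vec; []; _∷_; _++_; lookup)
open import Data.Vec.Properties
  using (lookup-++ˡ; lookup-++ʳ; lookup∘tabulate; tabulate-cong; tabulate∘lookup)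
open import Data.Vec.Relation.Unary.All using ([]; _∷_)
open import Data.Vec.Relation.Unary.All.Properties using (lookup⁺; lookup⁻; ++⁺)
open import Function.Base using (_∘_)
open import Function.Bundles using (_⇔_; mk⇔; Equivalence)
open import Function.Construct.Composition using (_⇔-∘_)
open import Function.Construct.Identity using (⇔-id)
open import Function.Construct.Symmetry using (⇔-sym)
open import Function.Related.TypeIsomorphisms using (→-cong-⇔; ¬-cong-⇔)
open import Relation.Binary.PropositionalEquality
  using (_≡_; refl; sym; trans; cong; cong₂; subst; ≡-≟-identity)
open import Relation.Nullary using (¬_; yes; no; ⌊_⌋; contradiction)
open import Relation.Nullary.Decidable using (toWitness; fromWitness; decidable-stable)
open import Relation.Unary using (Pred; Decidable)

open Equivalence using (to; from)

-- Equivalences for quantifiers, lists and vectors.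

∀-cong-⇔ : ∀ {A : Set} {B C : A → Set} → (∀ a → B a ⇔ C a) →
           (∀ a → B a) ⇔ (∀ a → C a)
∀-cong-⇔ B⇔C = mk⇔ (λ f a → to (B⇔C a) (f a)) (λ f a → from (B⇔C a) (f a))

∃-cong-⇔ : ∀ {A : Set} {B C : A → Set} → (∀ a → B a ⇔ C a) → ∃ B ⇔ ∃ C
∃-cong-⇔ B⇔C = mk⇔ (map₂ (to (B⇔C _))) (map₂ (from (B⇔C _)))

All-∷-⇔ : ∀ {A : Set} {P : Pred A 0ℓ} {x xs} →
          ListAll.All P (x ∷ xs) ⇔ (P x × ListAll.All P xs)
All-∷-⇔ = mk⇔ ListAll.uncons λ (p , ps) → p ∷ ps

Any-∷-⇔ : ∀ {A : Set} {P : Pred A 0ℓ} {x xs} →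
          Any P (x ∷ xs) ⇔ (P x ⊎ Any P xs)
Any-∷-⇔ = mk⇔ Any.toSum Any.fromSum

All-map-⇔ : ∀ {A B : Set} {P : Pred B 0ℓ} {Q : Pred A 0ℓ} {f : A → B} →
            (∀ x → P (f x) ⇔ Q x) → ∀ xs →
            ListAll.All P (List.map f xs) ⇔ ListAll.All Q xs
All-map-⇔ P⇔Q xs = mk⇔ (ListAll.map (to (P⇔Q _)) ∘ ListAll.map⁻)
                       (ListAll.gmap⁺ (from (P⇔Q _)))

lookup-injective : ∀ {A : Set} {k} (xs ys : Vec A k) →
                   (∀ i → lookup xs i ≡ lookup ys i) → xs ≡ ys
lookup-injective xs ys eq =
  trans (sym (tabulate∘lookup xs)) (trans (tabulate-cong eq) (tabulate∘lookup ys))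

Any-map-⇔ : ∀ {A B : Set} {P : Pred B 0ℓ} {Q : Pred A 0ℓ} {f : A → B} →
            (∀ x → P (f x) ⇔ Q x) → ∀ xs →
            Any P (List.map f xs) ⇔ Any Q xs
Any-map-⇔ P⇔Q xs = mk⇔ (Any.map (to (P⇔Q _)) ∘ Any.map⁻)
                       (Any.gmap (from (P⇔Q _)))

lookup⁺∘lookup⁻ : ∀ {A : Set} (P : A → Set) {k} (xs : Vec A k)
                  (f : ∀ i → P (lookup xs i)) i → lookup⁺ {P = P} {xs = xs} (lookup⁻ f) i ≡ f i
lookup⁺∘lookup⁻ P (_ ∷ _)  f zero    = refl
lookup⁺∘lookup⁻ P (_ ∷ xs) f (suc i) = lookup⁺∘lookup⁻ P xs (f ∘ suc) i

-- Substitution lemmas and the truth of iterated connectives.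

module _ {L : Language} (M : Structure L) where

  lookup-⟦⟧* : ∀ {p k} (ts : Vec (Term L p) k) ρ i →
               lookup (⟦ ts ⟧* M ρ) i ≡ ⟦ lookup ts i ⟧ M ρ
  lookup-⟦⟧* (t ∷ ts) ρ zero    = refl
  lookup-⟦⟧* (t ∷ ts) ρ (suc i) = lookup-⟦⟧* ts ρ i

  ⟦tabulate-var⟧* : ∀ {k} (a : Vec (Carrier M) k) → ⟦ Vec.tabulate var ⟧* M a ≡ a
  ⟦tabulate-var⟧* a = lookup-injective _ a λ i →
    trans (lookup-⟦⟧* (Vec.tabulate var) a i)
          (cong (λ t → ⟦ t ⟧ M a) (lookup∘tabulate var i))

  infix 4 _≗⟦_⟧_

  -- The assignment `ρ′` is the one obtained by evaluating `σ` under `ρ`. It is a record rather than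
  -- a function type so that `σ`, `ρ` and `ρ′` can be inferred from a proof.
  record _≗⟦_⟧_ {p q} (ρ′ : Vec (Carrier M) p) (σ : Fin p → Term L q)
                (ρ : Vec (Carrier M) q) : Set where
    constructor pointwise
    field ⟦_⟧≡lookup : ∀ x → ⟦ σ x ⟧ M ρ ≡ lookup ρ′ x

  open _≗⟦_⟧_

  module _ {p q : ℕ} {σ : Fin p → Term L q} {ρ : Vec (Carrier M) q}
           {ρ′ : Vec (Carrier M) p} (ρ′≗σρ : ρ′ ≗⟦ σ ⟧ ρ) where

    ⟦sub⟧  : ∀ t → ⟦ sub σ t ⟧ M ρ ≡ ⟦ t ⟧ M ρ′
    ⟦subs⟧ : ∀ {k} (ts : Vec (Term L p) k) → ⟦ subs σ ts ⟧* M ρ ≡ ⟦ ts ⟧* M ρ′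

    ⟦sub⟧ (var x)    = ⟦ ρ′≗σρ ⟧≡lookup x
    ⟦sub⟧ (fun f ts) = cong (⟦ M ⟧ᶠ f) (⟦subs⟧ ts)

    ⟦subs⟧ []       = refl
    ⟦subs⟧ (t ∷ ts) = cong₂ _∷_ (⟦sub⟧ t) (⟦subs⟧ ts)

  ≗⟦lift⟧ : ∀ {p q} {σ : Fin p → Term L q} {ρ ρ′} → ρ′ ≗⟦ σ ⟧ ρ →
            ∀ a → (a ∷ ρ′) ≗⟦ lift σ ⟧ (a ∷ ρ)
  ⟦ ≗⟦lift⟧ eq a ⟧≡lookup zero    = refl
  ⟦ ≗⟦lift⟧ {σ = σ} eq a ⟧≡lookup (suc x) =
    -- Weakening is itself a substitution, and `var ∘ suc` evaluated under `a ∷ ρ` gives back `ρ`.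
    trans (⟦sub⟧ (pointwise λ _ → refl) (σ x)) (⟦ eq ⟧≡lookup x)

  ≗⟦lift*⟧ : ∀ {p q} {σ : Fin p → Term L q} {ρ ρ′} → ρ′ ≗⟦ σ ⟧ ρ →
             ∀ {k} (a : Vec (Carrier M) k) → (a ++ ρ′) ≗⟦ lift* k σ ⟧ (a ++ ρ)
  ≗⟦lift*⟧ eq []      = eq
  ≗⟦lift*⟧ eq (a ∷ b) = ≗⟦lift⟧ (≗⟦lift*⟧ eq b) a

  module _ {n : ℕ} {ks : Vec ℕ n} {F G : Operator M ks}
           (F⇔G : ∀ R i a → F R i a ⇔ G R i a) where

    IsFixedPoint-cong : ∀ R → IsFixedPoint M F R ⇔ IsFixedPoint M G R
    IsFixedPoint-cong R = ∀-cong-⇔ λ i → ∀-cong-⇔ λ a →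
      mk⇔ (F⇔G R i a ⇔-∘_) (⇔-sym (F⇔G R i a) ⇔-∘_)

    -- An operator matters only up to equivalence of its values. This serves both the `lfp` case of
    -- substitution and the later passage from the formulas `Φ ψ` to the operator `Step`.
    LeastFixedPoint-cong : ∀ i a → LeastFixedPoint M F i a ⇔ LeastFixedPoint M G i a
    LeastFixedPoint-cong i a = ∃-cong-⇔ λ R →
      (IsFixedPoint-cong R ×-⇔
       ∀-cong-⇔ (λ S → →-cong-⇔ (IsFixedPoint-cong S) (⇔-id _))) ×-⇔ ⇔-id _

  Sat-⟨⟩ : ∀ {l n} {Δ : Vec ℕ n} {p q} {σ : Fin p → Term L q} {ρ ρ′} →
           ρ′ ≗⟦ σ ⟧ ρ → ∀ (φ : Formula L l Δ p) I →
           Sat M I ρ (φ ⟨ σ ⟩) ⇔ Sat M I ρ′ φ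
  Sat-⟨⟩ eq ⊥′         I = ⇔-id _
  Sat-⟨⟩ eq ⊤′         I = ⇔-id _
  Sat-⟨⟩ eq (t ≐ u)    I rewrite ⟦sub⟧ eq t | ⟦sub⟧ eq u = ⇔-id _
  Sat-⟨⟩ eq (rel r ts) I rewrite ⟦subs⟧ eq ts = ⇔-id _
  Sat-⟨⟩ eq (X · ts)   I rewrite ⟦subs⟧ eq ts = ⇔-id _
  Sat-⟨⟩ eq (¬′ φ)     I = ¬-cong-⇔ (Sat-⟨⟩ eq φ I)
  Sat-⟨⟩ eq (φ ∧′ χ)   I = Sat-⟨⟩ eq φ I ×-⇔ Sat-⟨⟩ eq χ I
  Sat-⟨⟩ eq (φ ∨′ χ)   I = Sat-⟨⟩ eq φ I ⊎-⇔ Sat-⟨⟩ eq χ I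
  Sat-⟨⟩ eq (φ ⇒ χ)    I = →-cong-⇔ (Sat-⟨⟩ eq φ I) (Sat-⟨⟩ eq χ I)
  Sat-⟨⟩ eq (∀′ φ)     I = ∀-cong-⇔ λ a → Sat-⟨⟩ (≗⟦lift⟧ eq a) φ I
  Sat-⟨⟩ eq (∃′ φ)     I = ∃-cong-⇔ λ a → Sat-⟨⟩ (≗⟦lift⟧ eq a) φ I
  Sat-⟨⟩ eq (∀ᵖ φ)     I = ∀-cong-⇔ λ R → Sat-⟨⟩ eq φ (R ∷ I)
  Sat-⟨⟩ eq (∃ᵖ φ)     I = ∃-cong-⇔ λ R → Sat-⟨⟩ eq φ (R ∷ I)
  Sat-⟨⟩ eq (lfp ks Φ _ i ts) I rewrite ⟦subs⟧ eq ts =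
    LeastFixedPoint-cong
      (λ R j a → Sat-⟨⟩ (≗⟦lift*⟧ eq a) (Φ j) (++⁺ I R)) i _

  -- Substituting formulas that define `R` amounts to interpreting the predicate variables by `R`.
  -- As each `χ j` has only its arguments free, the hypothesis does not involve `ρ` and passes
  -- unchanged under quantifiers.
  Sat-[] : ∀ {l m n} {Δ : Vec ℕ m} {Δ′ : Vec ℕ n}
           {χ : ∀ j → Formula L l Δ′ (lookup Δ j)} {I R} →
           (∀ j a → Sat M I a (χ j) ⇔ holds M R j a) →
           ∀ {p} (φ : Formula L FO Δ p) ρ →
           Sat M I ρ (φ [ χ ]) ⇔ Sat M R ρ φ
  Sat-[] χ⇔R ⊥′         ρ = ⇔-id _
  Sat-[] χ⇔R ⊤′         ρ = ⇔-id _
  Sat-[] χ⇔R (t ≐ u)    ρ = ⇔-id _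
  Sat-[] χ⇔R (rel r ts) ρ = ⇔-id _
  Sat-[] {χ = χ} {I} χ⇔R (X · ts) ρ =
    χ⇔R X (⟦ ts ⟧* M ρ) ⇔-∘ Sat-⟨⟩ (pointwise λ i → sym (lookup-⟦⟧* ts ρ i)) (χ X) I
  Sat-[] χ⇔R (¬′ φ)     ρ = ¬-cong-⇔ (Sat-[] χ⇔R φ ρ)
  Sat-[] χ⇔R (φ ∧′ θ)   ρ = Sat-[] χ⇔R φ ρ ×-⇔ Sat-[] χ⇔R θ ρ
  Sat-[] χ⇔R (φ ∨′ θ)   ρ = Sat-[] χ⇔R φ ρ ⊎-⇔ Sat-[] χ⇔R θ ρ
  Sat-[] χ⇔R (φ ⇒ θ)    ρ = →-cong-⇔ (Sat-[] χ⇔R φ ρ) (Sat-[] χ⇔R θ ρ)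
  Sat-[] χ⇔R (∀′ φ)     ρ = ∀-cong-⇔ λ a → Sat-[] χ⇔R φ (a ∷ ρ)
  Sat-[] χ⇔R (∃′ φ)     ρ = ∃-cong-⇔ λ a → Sat-[] χ⇔R φ (a ∷ ρ)

  module _ {l : Logic} {n : ℕ} {Δ : Vec ℕ n} {I : Relations M Δ} where

    Sat-embed : ∀ {p} (φ : Formula L FO [] p) ρ →
                Sat M I ρ (embed {l = l} φ) ⇔ Sat M [] ρ φ
    Sat-embed φ = Sat-[] (λ ()) φ

    Sat-⋀ : ∀ {p} {ρ : Vec (Carrier M) p} (φs : List (Formula L l Δ p)) →
            Sat M I ρ (⋀ φs) ⇔ ListAll.All (Sat M I ρ) φs
    Sat-⋀ []               = mk⇔ (λ _ → []) _
    Sat-⋀ (φ ∷ [])         = mk⇔ (_∷ []) ListAll.head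
    Sat-⋀ (φ ∷ φs@(_ ∷ _)) = ⇔-sym All-∷-⇔ ⇔-∘ (⇔-id _ ×-⇔ Sat-⋀ φs)

    Sat-⋁ : ∀ {p} {ρ : Vec (Carrier M) p} (φs : List (Formula L l Δ p)) →
            Sat M I ρ (⋁ φs) ⇔ Any (Sat M I ρ) φs
    Sat-⋁ []               = mk⇔ (λ ()) (λ ())
    Sat-⋁ (φ ∷ [])         = mk⇔ here Any.singleton⁻
    Sat-⋁ (φ ∷ φs@(_ ∷ _)) = ⇔-sym Any-∷-⇔ ⇔-∘ (⇔-id _ ⊎-⇔ Sat-⋁ φs)

    Sat-∀* : ∀ {p} (φ : Formula L l Δ p) →
             Sat M I [] (∀* φ) ⇔ (∀ ρ → Sat M I ρ φ)
    Sat-∀* {zero}  φ = mk⇔ (λ { s [] → s }) (λ f → f [])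
    Sat-∀* {suc p} φ =
      mk⇔ (λ { f (a ∷ ρ) → f ρ a }) (λ f ρ a → f (a ∷ ρ)) ⇔-∘ Sat-∀* (∀′ φ)

    Sat-∃* : ∀ p {q} {ρ : Vec (Carrier M) q} (φ : Formula L l Δ (p + q)) →
             Sat M I ρ (∃* p φ) ⇔ ∃ λ (σ : Vec (Carrier M) p) → Sat M I (σ ++ ρ) φ
    Sat-∃* zero    φ = mk⇔ ([] ,_) (λ { ([] , s) → s })
    Sat-∃* (suc p) φ =
      mk⇔ (λ (σ , a , s) → a ∷ σ , s) (λ { (a ∷ σ , s) → σ , a , s })
      ⇔-∘ Sat-∃* p (∃′ φ)

  Sat-∃ᵖ* : ∀ {n} {Δ : Vec ℕ n} {p ρ} (φ : Formula L SO Δ p) →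
            Sat M [] ρ (∃ᵖ* φ) → ∃ λ I → Sat M I ρ φ
  Sat-∃ᵖ* {Δ = []}    φ s = [] , s
  Sat-∃ᵖ* {Δ = k ∷ Δ} φ s =
    let I , R , s′ = Sat-∃ᵖ* (∃ᵖ φ) s in R ∷ I , s′

-- Closed tuples, models of clause sets and duality.

module _ {L : Language} (M : Structure L) {n : ℕ} {ks : Vec ℕ n} where

  infix 4 _⊑_

  _⊑_ : Relations M ks → Relations M ks → Set
  R ⊑ S = ∀ i a → holds M R i a → holds M S i a

  Monotone : Operator M ks → Set
  Monotone F = ∀ R S → R ⊑ S → ∀ i a → F R i a → F S i a

  -- These are the pre-fixed points of `F`.
  IsClosed : Operator M ks → Relations M ks → Set
  IsClosed F R = ∀ i a → F R i a → holds M R i a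

  Complementary : Relations M ks → Relations M ks → Set
  Complementary R S = ∀ i a → holds M S i a ⇔ (¬ holds M R i a)

  -- Relations are two-valued, so a double negation of membership can be cancelled.
  Complementary-sym : ∀ R S → Complementary R S → Complementary S R
  Complementary-sym R S S≡¬R i a =
    ¬-cong-⇔ (⇔-sym (S≡¬R i a)) ⇔-∘
    mk⇔ (λ r ¬r → ¬r r) (decidable-stable (T? (lookup⁺ R i a)))

  module _ {p : ℕ} where

    Holds : Relations M ks → Vec (Carrier M) p → Atom L ks p → Set
    Holds R ρ (X , ts) = holds M R X (⟦ ts ⟧* M ρ)

    Holds? : ∀ R ρ → Decidable (Holds R ρ)
    Holds? R ρ (X , ts) = T? _

    Premise Satisfies : Relations M ks → Vec (Carrier M) p → Clause L ks p → Set
    Premise R ρ C = Sat M [] ρ (constraint C) × ListAll.All (Holds R ρ) (body C)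
    Satisfies R ρ C = Premise R ρ C → Any (Holds R ρ) (head C)

    Model : Relations M ks → List (Clause L ks p) → Set
    Model R ψ = ∀ ρ → ListAll.All (Satisfies R ρ) ψ

    Premise-mono : ∀ R S → R ⊑ S → ∀ {ρ} C → Premise R ρ C → Premise S ρ C
    Premise-mono R S R⊑S C (φ , αs) = φ , ListAll.map (R⊑S _ _) αs

    -- The operator F_{Φ_ψ}, with ∃ȳ and the disjunction spelled out.
    Step : List (Clause L ks p) → Operator M ks
    Step ψ R j a = ∃ λ ρ → Any (λ C → ∃ λ ts →
      head C ≡ (j , ts) ∷ [] × Premise R ρ C × a ≡ ⟦ ts ⟧* M ρ) ψ

    Step-mono : ∀ ψ → Monotone (Step ψ)
    Step-mono ψ R S R⊑S j a (ρ , d) =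
      ρ , Any.map (λ {C} (ts , eq , pr , a≡) → ts , eq , Premise-mono R S R⊑S C pr , a≡) d

    -- Whatever `Step` derives is the value of the single head atom of a clause whose premise holds,
    -- and a model makes that atom true.
    Model⇒closed : ∀ ψ R → Model R ψ → IsClosed (Step ψ) R
    Model⇒closed ψ R m j a (ρ , d) =
      let sat , ts , eq , pr , a≡ = ListAll.lookupAny (m ρ) d in
      subst (holds M R j) (sym a≡) (Any.singleton⁻ (subst (Any (Holds R ρ)) eq (sat pr)))

    -- The clauses with head ⊥ are inherited by every R below a model.
    closed⇒Model : ∀ {ψ} → Horn ψ → ∀ R S → IsClosed (Step ψ) R →
                   R ⊑ S → Model S ψ → Model R ψ
    closed⇒Model {ψ} horn R S closed R⊑S m ρ = ListAll.tabulate λ {C} C∈ψ →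
      satisfies C (ListAll.lookup horn C∈ψ) (ListAll.lookup (m ρ) C∈ψ)
        -- The clause that derives the head in `Step` is `C` itself, under the same assignment `ρ`.
        λ j ts eq pr → closed j _ (ρ , Any.map (λ { refl → ts , eq , pr , refl }) C∈ψ)
      where
      satisfies : ∀ C → List.length (head C) ≤ 1 → Satisfies S ρ C →
                  (∀ j ts → head C ≡ (j , ts) ∷ [] → Premise R ρ C →
                   holds M R j (⟦ ts ⟧* M ρ)) →
                  Satisfies R ρ C
      satisfies C h sat derive pr with head C
      ... | []            = contradiction (sat (Premise-mono R S R⊑S C pr)) λ ()
      ... | (j , ts) ∷ [] = here (derive j ts refl pr)
      ... | _ ∷ _ ∷ _     = contradiction h λ { (s≤s ()) }

    -- If every body atom held in `R`, some head atom would hold in `R`, although all of them hold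
    -- in the complement `S`. Decidability of the atoms then yields a body atom that fails in `R`.
    Model-dual : ∀ ψ R S → Complementary R S → Model R ψ → Model S (dual ψ)
    Model-dual ψ R S S≡¬R m ρ = ListAll.map⁺ (ListAll.map (λ {C} → contrapose C) (m ρ))
      where
      contrapose : ∀ C → Satisfies R ρ C → Sat M [] ρ (constraint C) ×
                   ListAll.All (Holds S ρ) (head C) → Any (Holds S ρ) (body C)
      contrapose C sat (φ , ¬αs) = Any.map (from (S≡¬R _ _))
        (ListAll.¬All⇒Any¬ (Holds? R ρ) (body C) λ βs →
          ListAll.All¬⇒¬Any (ListAll.map (to (S≡¬R _ _)) ¬αs) (sat (φ , βs)))

    dual-dual : ∀ (ψ : List (Clause L ks p)) → dual (dual ψ) ≡ ψ
    dual-dual []      = refl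
    -- Swapping body and head twice returns `C` definitionally, by eta for records.
    dual-dual (C ∷ ψ) = cong (C ∷_) (dual-dual ψ)

    Model-dual⁻ : ∀ ψ R S → Complementary R S → Model S (dual ψ) → Model R ψ
    Model-dual⁻ ψ R S S≡¬R m =
      subst (Model R) (dual-dual ψ)
        (Model-dual (dual ψ) S R (Complementary-sym R S S≡¬R) m)

    -- The formulas `matrix ψ` and `Φ ψ` express `Model` and `Step`.

    module _ {l : Logic} {R : Relations M ks} where

      Sat-premise : ∀ C ρ → ListAll.All (Sat M R ρ) (premise {l = l} C) ⇔ Premise R ρ C
      Sat-premise C ρ =
        (Sat-embed M (constraint C) ρ ×-⇔ All-map-⇔ (λ _ → ⇔-id _) (body C)) ⇔-∘
        All-∷-⇔

      Sat-clause : ∀ C ρ → Sat M R ρ (clause {l = l} C) ⇔ Satisfies R ρ C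
      Sat-clause C ρ = →-cong-⇔
        (Sat-premise C ρ ⇔-∘ Sat-⋀ M (premise C))
        (Any-map-⇔ (λ _ → ⇔-id _) (head C) ⇔-∘ Sat-⋁ M _)

      Sat-matrix : ∀ ψ → Sat M R [] (matrix {l = l} ψ) ⇔ Model R ψ
      Sat-matrix ψ =
        (∀-cong-⇔ λ ρ → All-map-⇔ (λ C → Sat-clause C ρ) ψ ⇔-∘ Sat-⋀ M _) ⇔-∘
        Sat-∀* M (⋀ (List.map clause ψ))

      -- The part `ρ` of the assignment interprets the clause variables and `a` the fresh tuple,
      -- whose componentwise equations combine into one equation of vectors.
      Sat-disjunct : ∀ j C s a ρ →
                     Sat M R (ρ ++ a) (disjunct {l = l} j C s) ⇔
                     (Premise R ρ C × a ≡ ⟦ s ⟧* M ρ)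
      Sat-disjunct j C s a ρ =
        ((Sat-premise C ρ ⇔-∘ All-map-⇔ (λ φ → Sat-⟨⟩ M ρ≗y φ R) (premise C)) ×-⇔
         mk⇔ (λ e → lookup-injective a _ λ i → to (equation i) (ListAll.tabulate⁻ e i))
             (λ e → ListAll.tabulate⁺ λ i →
               from (equation i) (cong (λ as → lookup as i) e))) ⇔-∘
        (mk⇔ (ListAll.++⁻ _) (λ (xs , ys) → ListAll.++⁺ xs ys) ⇔-∘ Sat-⋀ M _)
        where
        ρ≗y : _≗⟦_⟧_ M ρ (λ v → var (v ↑ˡ lookup ks j)) (ρ ++ a)
        ρ≗y = pointwise (lookup-++ˡ ρ a)

        equation : ∀ i →
          lookup (ρ ++ a) (p ↑ʳ i) ≡
            ⟦ sub (λ v → var (v ↑ˡ lookup ks j)) (lookup s i) ⟧ M (ρ ++ a) ⇔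
          lookup a i ≡ lookup (⟦ s ⟧* M ρ) i
        equation i rewrite lookup-++ʳ ρ a i
                         | ⟦sub⟧ M ρ≗y (lookup s i)
                         | lookup-⟦⟧* M s ρ i = ⇔-id _

      conclusion-sound : ∀ j (C : Clause L ks p) {ts} →
                         conclusion j C ≡ just ts → head C ≡ (j , ts) ∷ []
      conclusion-sound j C eq with head C
      ... | (X , us) ∷ [] with X ≟ j
      conclusion-sound j C refl | (X , us) ∷ [] | yes refl = refl

      conclusion-complete : ∀ j (C : Clause L ks p) {ts} →
                            head C ≡ (j , ts) ∷ [] → conclusion j C ≡ just ts
      conclusion-complete j C eq with head C
      -- For a variable `j` the test `j ≟ j` is stuck; rewriting turns it into `yes refl`.
      conclusion-complete j C refl | _
        rewrite ≡-≟-identity _≟_ {j} refl = refl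

      Sat-disjuncts : ∀ j ψ a ρ →
        Any (Sat M R (ρ ++ a)) (disjuncts {l = l} j ψ) ⇔
        Any (λ C → ∃ λ ts → head C ≡ (j , ts) ∷ [] × Premise R ρ C × a ≡ ⟦ ts ⟧* M ρ) ψ
      Sat-disjuncts j []      a ρ = mk⇔ (λ ()) (λ ())
      Sat-disjuncts j (C ∷ ψ) a ρ with conclusion j C in eq
      ... | nothing = mk⇔ (there ∘ to (Sat-disjuncts j ψ a ρ)) λ where
              (here (ts , h , _)) →
                contradiction (trans (sym eq) (conclusion-complete j C h)) λ ()
              (there d) → from (Sat-disjuncts j ψ a ρ) d
      ... | just s = ⇔-sym Any-∷-⇔ ⇔-∘
              (((unique ⇔-∘ Sat-disjunct j C s a ρ) ⊎-⇔ Sat-disjuncts j ψ a ρ) ⇔-∘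
              Any-∷-⇔)
        where
        -- The tuple `ts` is determined by the head of `C`, so the existential quantifier over it
        -- has `s` as its only witness.
        unique : (Premise R ρ C × a ≡ ⟦ s ⟧* M ρ) ⇔
                 ∃ λ ts → head C ≡ (j , ts) ∷ [] × Premise R ρ C × a ≡ ⟦ ts ⟧* M ρ
        unique = mk⇔ (λ (pr , e) → s , conclusion-sound j C eq , pr , e)
          λ (ts , h , pr , e) → pr , trans e (cong (λ us → ⟦ us ⟧* M ρ)
            (just-injective (trans (sym (conclusion-complete j C h)) eq)))

      Sat-Φ : ∀ ψ j a → Sat M R a (Φ {l = l} ψ j) ⇔ Step ψ R j a
      Sat-Φ ψ j a =
        ∃-cong-⇔ (λ ρ → Sat-disjuncts j ψ a ρ ⇔-∘ Sat-⋁ M (disjuncts j ψ)) ⇔-∘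
        Sat-∃* M p (⋁ (disjuncts j ψ))

-- Comprehension and least fixed points of monotone operators.

module _ (em : ExcludedMiddle 0ℓ) {L : Language} (M : Structure L)
         {n : ℕ} {ks : Vec ℕ n} where

  -- Excluded middle decides membership and thus turns arbitrary predicates into two-valued
  -- relations.
  comprehension : (∀ i → Pred (Vec (Carrier M) (lookup ks i)) 0ℓ) → Relations M ks
  comprehension P = lookup⁻ λ i a → ⌊ em {P i a} ⌋

  holds-comprehension : ∀ P i a → holds M (comprehension P) i a ⇔ P i a
  holds-comprehension P i a
    rewrite lookup⁺∘lookup⁻ (Relation M) ks (λ i a → ⌊ em {P i a} ⌋) i =
    mk⇔ toWitness fromWitness

  complement : Relations M ks → Relations M ks
  complement R = comprehension λ i a → ¬ holds M R i a

  complement-complementary : ∀ R → Complementary M R (complement R)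
  complement-complementary R = holds-comprehension λ i a → ¬ holds M R i a

  module _ (F : Operator M ks) where

    -- The intersection of all closed tuples, as in the Knaster-Tarski theorem. Two-valued relations
    -- keep this impredicative quantification inside `Set`, where comprehension applies.
    leastClosed : Relations M ks
    leastClosed = comprehension λ i a → ∀ S → IsClosed M F S → holds M S i a

    holds-leastClosed : ∀ i a →
      holds M leastClosed i a ⇔ (∀ S → IsClosed M F S → holds M S i a)
    holds-leastClosed = holds-comprehension _

    leastClosed-least : ∀ S → IsClosed M F S → _⊑_ M leastClosed S
    leastClosed-least S closed i a r = to (holds-leastClosed i a) r S closed

    module _ (mono : Monotone M F) where

      leastClosed-closed : IsClosed M F leastClosed
      leastClosed-closed i a f = from (holds-leastClosed i a) λ S closed →
        closed i a (mono leastClosed S (leastClosed-least S closed) i a f)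

      -- A monotone operator maps closed tuples to closed tuples, so the least one lies below its
      -- own image.
      leastClosed-fixed : IsFixedPoint M F leastClosed
      leastClosed-fixed i a = mk⇔
        (to (holds-image i a) ∘ leastClosed-least image image-closed i a)
        (leastClosed-closed i a)
        where
        -- `F leastClosed` consists of predicates; minimality speaks of relations, hence the
        -- comprehension.
        image : Relations M ks
        image = comprehension (F leastClosed)

        holds-image : ∀ i a → holds M image i a ⇔ F leastClosed i a
        holds-image = holds-comprehension (F leastClosed)

        image-closed : IsClosed M F image
        image-closed i a = from (holds-image i a) ∘
          mono image leastClosed
            (λ i a → leastClosed-closed i a ∘ to (holds-image i a)) i a

      -- Minimality among fixed points and among closed tuples agree, because `leastClosed` is a
      -- fixed point and every fixed point is closed.
      LeastFixedPoint⇔leastClosed : ∀ i a →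
        LeastFixedPoint M F i a ⇔ holds M leastClosed i a
      LeastFixedPoint⇔leastClosed i a = mk⇔
        (λ (R , (_ , least) , r) → least leastClosed leastClosed-fixed i a r)
        (λ r → leastClosed ,
          (leastClosed-fixed ,
           λ S fixed → leastClosed-least S λ i a → from (fixed i a)) , r)

  -- Least and greatest models, and their definability by `μ` and `ν`.

  module _ {p : ℕ} (ψ : List (Clause L ks p)) where

    -- Defined for every `ψ`; it is shown to be a model when `ψ` is Horn and has some model.
    leastModel : Relations M ks
    leastModel = leastClosed (Step M ψ)

    leastModel⊑ : ∀ R → Model M R ψ → _⊑_ M leastModel R
    leastModel⊑ R m = leastClosed-least (Step M ψ) R (Model⇒closed M ψ R m)

    leastModel-model : Horn ψ → ∀ R → Model M R ψ → Model M leastModel ψ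
    leastModel-model horn R m = closed⇒Model M horn leastModel R
      (leastClosed-closed (Step M ψ) (Step-mono M ψ)) (leastModel⊑ R m) m

    Sat-μ : ∀ j a → Sat M [] a (μ ψ j) ⇔ holds M leastModel j a
    Sat-μ j a =
      -- `μ ψ j` applies the fixed point to its own variables, a tuple that evaluates to `a`.
      subst (λ b → LeastFixedPoint M F j b ⇔ holds M leastModel j a)
        (sym (⟦tabulate-var⟧* M a))
        (LeastFixedPoint⇔leastClosed (Step M ψ) (Step-mono M ψ) j a ⇔-∘
         LeastFixedPoint-cong M F⇔Step j a)
      where
      -- The bound tuple `b` precedes the outer arguments `a`, and the weakened `Φ ψ i` reads its
      -- variables from `b`.
      F : Operator M ks
      F R i b = Sat M R (b ++ a) (Φ ψ i ⟨ (λ x → var (x ↑ˡ lookup ks j)) ⟩)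

      F⇔Step : ∀ R i b → F R i b ⇔ Step M ψ R i b
      F⇔Step R i b =
        Sat-Φ M ψ i b ⇔-∘ Sat-⟨⟩ M (pointwise (lookup-++ˡ b a)) (Φ ψ i) R

  module _ {p : ℕ} (ψ : List (Clause L ks p)) where

    greatestModel : Relations M ks
    greatestModel = complement (leastModel (dual ψ))

    greatestModel-complementary : Complementary M (leastModel (dual ψ)) greatestModel
    greatestModel-complementary = complement-complementary (leastModel (dual ψ))

    complement-model : ∀ R → Model M R ψ → Model M (complement R) (dual ψ)
    complement-model R = Model-dual M ψ R (complement R) (complement-complementary R)

    -- An element of both `R` and the least model of `dual ψ` would also lie in `complement R`, as
    -- the latter is a model of `dual ψ`.
    ⊑greatestModel : ∀ R → Model M R ψ → _⊑_ M R greatestModel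
    ⊑greatestModel R m i a r = from (greatestModel-complementary i a) λ d →
      to (complement-complementary R i a)
         (leastModel⊑ (dual ψ) (complement R) (complement-model R m) i a d) r

    greatestModel-model : DualHorn ψ → ∀ R → Model M R ψ → Model M greatestModel ψ
    greatestModel-model dualHorn R m =
      Model-dual⁻ M ψ greatestModel (leastModel (dual ψ))
        (Complementary-sym M (leastModel (dual ψ)) greatestModel
          greatestModel-complementary)
        -- The heads of `dual ψ` are the bodies of `ψ`, so dual Horn for `ψ` is Horn for `dual ψ`;
        -- `complement R` witnesses that `dual ψ` has a model.
        (leastModel-model (dual ψ) (ListAll.map⁺ dualHorn) (complement R)
          (complement-model R m))

    Sat-ν : ∀ j a → Sat M [] a (ν ψ j) ⇔ holds M greatestModel j a
    Sat-ν j a =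
      ⇔-sym (greatestModel-complementary j a) ⇔-∘ ¬-cong-⇔ (Sat-μ (dual ψ) j a)

theorem11 : ExcludedMiddle 0ℓ →
    ∀ {L : Language} {n} {ks : Vec ℕ n} {p} (ψ : List (Clause L ks p)) →
    LinearHorn ψ →
    ⊨ formulaEquation ψ →
    ((⊨ matrix ψ [ μ ψ ]) × (⊨ matrix ψ [ ν ψ ])) ×
    ((χ : ∀ j → Formula L FO[LFP] [] (lookup ks j)) →
    ⊨ matrix ψ [ χ ] →
    ⊨ ⋀ (tabulate (λ j → (μ ψ j ⟶ χ j) ∧′ (χ j ⟶ ν ψ j))))
theorem11 em {L} {ks = ks} ψ (horn , dualHorn) valid =
  -- Validity enters through the model `R`, which serves as a witness that `ψ` has some model in
  -- `M`.
  ( (λ M → let R , m = model M in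
      from (Sat-matrix-[] M (μ ψ) (leastModel em M ψ) (Sat-μ em M ψ))
           (leastModel-model em M ψ horn R m))
  , (λ M → let R , m = model M in
      from (Sat-matrix-[] M (ν ψ) (greatestModel em M ψ) (Sat-ν em M ψ))
           (greatestModel-model em M ψ dualHorn R m)) )
  , λ χ valid-χ M →
    -- The formulas `χ` enter through the relations `R` that they define in `M`, and the extremality
    -- of the two models is applied to `R`.
    let R : Relations M ks
        R = comprehension em M λ j a → Sat M [] a (χ j)
        χ⇔R : ∀ j a → Sat M [] a (χ j) ⇔ holds M R j a
        χ⇔R j a = ⇔-sym (holds-comprehension em M {ks = ks} _ j a)
        m : Model M R ψ
        m = to (Sat-matrix-[] M χ R χ⇔R) (valid-χ M)
    in
    from (Sat-⋀ M _) (ListAll.tabulate⁺ λ j →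
      from (Sat-∀* M (μ ψ j ⇒ χ j))
        (λ a → from (χ⇔R j a) ∘ leastModel⊑ em M ψ R m j a ∘ to (Sat-μ em M ψ j a)) ,
      from (Sat-∀* M (χ j ⇒ ν ψ j))
        (λ a → from (Sat-ν em M ψ j a) ∘ ⊑greatestModel em M ψ R m j a ∘ to (χ⇔R j a)))
  where
  model : ∀ M → ∃ λ R → Model M R ψ
  model M = let I , s = Sat-∃ᵖ* M (matrix ψ) (valid M) in I , to (Sat-matrix M {R = I} ψ) s

  Sat-matrix-[] : ∀ M {l} (χ : ∀ j → Formula L l [] (lookup ks j)) R →
                  (∀ j a → Sat M [] a (χ j) ⇔ holds M R j a) →
                  Sat M [] [] (matrix ψ [ χ ]) ⇔ Model M R ψ
  Sat-matrix-[] M χ R χ⇔R = Sat-matrix M {R = R} ψ ⇔-∘ Sat-[] M χ⇔R (matrix ψ) []
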